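{- Let $C$ be an extended linear code of length $d+1$ over $\mathbb{Z}_N$ and let $g=(g_{ji})$ be a generating matrix of $C$, with $m$ rows and with columns indexed by $i=0,\dots,d$. Put $\gcd_i=\gcd(g_{1i},\dots,g_{mi},N)$. If $C$ is thin and every $\gcd_i=1$ (in particular, if $N$ is prime), then $d\ge N$.
   Context: $\mathbb{Z}_N=\mathbb{Z}/N\mathbb{Z}$; its elements are identified with the representatives $0,1,\dots,N-1$, and gcd's are taken of these integers. A linear code of length $n$ over $\mathbb{Z}_N$ is a submodule $C\subseteq\mathbb{Z}_N^n$; its elements are called words; a generating matrix is a matrix whose rows generate $C$. $C$ is extended if every word has coordinate sum $0\bmod N$. An extended code is thin if it contains no word all of whose entries are nonzero.
   Formalization: N ≥ 2 is assumed (for N = 1, d = 0, C = {0} the claim fails), and in the prime case it is also assumed that no column of g is zero (otherwise N = 2, d = 0, C = {0}, g = (0) is a counterexample). -}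

module Defs where

open import Data.Fin.Base using (Fin; toℕ)
open import Data.Nat.Base as ℕ using (ℕ; NonZero)
open import Data.Nat.DivMod using (_mod_)
open import Data.Nat.GCD using (gcd)
open import Data.Product.Base using (∃-syntax; _×_)
open import Data.Vec.Base using (Vec; map; zipWith; replicate; foldr′; lookup)
open import Data.Vec.Relation.Unary.All using (All)
open import Function.Bundles using (_⇔_)
open import Level using (Level) renaming (suc to lsuc)
open import Relation.Binary.PropositionalEquality using (_≡_; _≢_)
open import Relation.Nullary.Negation using (¬_)
open import Relation.Unary using (Pred)

-- ℤ/N, each class being its representative in {0, …, N-1}.
ℤ/ : ℕ → Set
ℤ/ N = Fin N

module _ {N : ℕ} .{{_ : NonZero N}} where

  infixl 6 _+_ _+ᵛ_
  infixl 7 _*_ _*ᵛ_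

  0# : ℤ/ N
  0# = 0 mod N

  _+_ : ℤ/ N → ℤ/ N → ℤ/ N
  a + b = (toℕ a ℕ.+ toℕ b) mod N

  _*_ : ℤ/ N → ℤ/ N → ℤ/ N
  a * b = (toℕ a ℕ.* toℕ b) mod N

  sum : ∀ {n} → Vec (ℤ/ N) n → ℤ/ N
  sum = foldr′ _+_ 0#

  0ᵛ : ∀ {n} → Vec (ℤ/ N) n
  0ᵛ {n} = replicate n 0#

  _+ᵛ_ : ∀ {n} → Vec (ℤ/ N) n → Vec (ℤ/ N) n → Vec (ℤ/ N) n
  _+ᵛ_ = zipWith _+_

  _*ᵛ_ : ∀ {n} → ℤ/ N → Vec (ℤ/ N) n → Vec (ℤ/ N) n
  a *ᵛ v = map (a *_) v

-- Negation is scalar multiplication by N-1, so closure under it is implied.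
record LinearCode (N : ℕ) .{{_ : NonZero N}} (n : ℕ) (ℓ : Level) : Set (lsuc ℓ) where
  field
    IsWord   : Pred (Vec (ℤ/ N) n) ℓ
    0-closed : IsWord 0ᵛ
    +-closed : ∀ {v w} → IsWord v → IsWord w → IsWord (v +ᵛ w)
    *-closed : ∀ a {v} → IsWord v → IsWord (a *ᵛ v)

open LinearCode public

Matrix : ℕ → ℕ → ℕ → Set
Matrix N m n = Vec (Vec (ℤ/ N) n) m

module _ {N : ℕ} .{{_ : NonZero N}} {n : ℕ} where

  linearCombination : ∀ {m} → Vec (ℤ/ N) m → Matrix N m n → Vec (ℤ/ N) n
  linearCombination a g = foldr′ _+ᵛ_ 0ᵛ (zipWith _*ᵛ_ a g)

  IsGeneratingMatrix : ∀ {m ℓ} → Matrix N m n → LinearCode N n ℓ → Set ℓ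
  IsGeneratingMatrix g C = ∀ w → IsWord C w ⇔ (∃[ a ] w ≡ linearCombination a g)

  Extended : ∀ {ℓ} → LinearCode N n ℓ → Set ℓ
  Extended C = ∀ w → IsWord C w → sum w ≡ 0#

  Thin : ∀ {ℓ} → LinearCode N n ℓ → Set ℓ
  Thin C = ¬ (∃[ w ] IsWord C w × All (_≢ 0#) w)

column : ∀ {N m n} → Matrix N m n → Fin n → Vec (ℤ/ N) m
column g i = map (λ row → lookup row i) g

columnGcd : ∀ {N m n} → Matrix N m n → Fin n → ℕ
columnGcd {N} g i = foldr′ gcd N (map toℕ (column g i))

{-# OPTIONS --safe #-}
-- Count the zero entries of the words a·g, with a ranging over all N^m coefficient vectors.
-- A column of gcd 1 takes the value 1 at some b, so translating a by the multiples of b shows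
-- that it vanishes at exactly one N-th of the vectors; the total is thus (d + 1) N^m / N.
-- Thinness puts at least one zero in each word, and the zero word has d + 1 of them, so for
-- d ≥ 1 the total exceeds N^m and d + 1 > N.  For d = 0 the weak inequality gives N ≤ 1.
module Submission where

open import Defs
open import Algebra.Properties.Semiring.Sum as SemiringSum using ()
open import Data.Fin.Base using (Fin; zero; suc; toℕ)
open import Data.Fin.Permutation using (permutation)
open import Data.Fin.Properties using (toℕ<n; toℕ-injective; toℕ-fromℕ<)
open import Data.Nat.Base as ℕ using (ℕ; zero; suc; pred; _≤_; _<_; _≥_; z≤n; s≤s; NonZero)
open import Data.Nat.DivMod using (_mod_; _%_; %-distribˡ-+; %-distribˡ-*; [m+kn]%n≡m%n; m<n⇒m%n≡m; m%n<n)
open import Data.Nat.Divisibility using (_∣_; ∣-refl; ∣-trans; ∣⇒≤)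
open import Data.Nat.GCD using (gcd; gcd[m,n]∣m; gcd[m,n]∣n; gcd-GCD; module Bézout)
open import Data.Nat.Primality using (Prime; prime⇒irreducible)
open import Data.Nat.Properties as ℕₚ using (module ≤-Reasoning)
open import Data.Nat.Tactic.RingSolver using (solve-∀)
open import Data.Product.Base using (_×_; _,_; ∃-syntax)
open import Data.Sum.Base using (inj₁; inj₂)
open import Data.Vec.Base using (Vec; []; _∷_; lookup; map; foldr′)
open import Data.Vec.Properties using (lookup-map; lookup-zipWith; lookup-replicate)
open import Data.Vec.Relation.Unary.All.Properties using (lookup⁻)
open import Function.Base using (_∘_)
open import Function.Bundles using (Equivalence)
open import Relation.Binary.PropositionalEquality using (_≡_; _≢_; refl; sym; trans; cong; cong₂; subst; module ≡-Reasoning)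
open import Relation.Nullary.Negation using (contradiction)

open SemiringSum ℕₚ.+-*-semiring using (*-distribˡ-sum; sum-syntax; sum-cong-≗; ∑-comm; ∑-permute)
  renaming (sum to Σ)

-- Arithmetic of ℤ/N

module _ {N : ℕ} .{{_ : NonZero N}} where

  toℕ-mod : ∀ n → toℕ (n mod N) ≡ n % N
  toℕ-mod n = toℕ-fromℕ< (m%n<n n N)

  mod-toℕ : ∀ (a : ℤ/ N) → toℕ a mod N ≡ a
  mod-toℕ a = toℕ-injective (trans (toℕ-mod (toℕ a)) (m<n⇒m%n≡m (toℕ<n a)))

  mod-cong : ∀ {m n} → m % N ≡ n % N → m mod N ≡ n mod N
  mod-cong {m} {n} eq = toℕ-injective (trans (toℕ-mod m) (trans eq (sym (toℕ-mod n))))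

  mod-+-multiple : ∀ m k → (m ℕ.+ k ℕ.* N) mod N ≡ m mod N
  mod-+-multiple m k = mod-cong ([m+kn]%n≡m%n m k N)

  mod-homo-+ : ∀ m n → (m mod N) + (n mod N) ≡ (m ℕ.+ n) mod N
  mod-homo-+ m n = mod-cong (trans
    (cong₂ (λ x y → (x ℕ.+ y) % N) (toℕ-mod m) (toℕ-mod n))
    (sym (%-distribˡ-+ m n N)))

  mod-homo-* : ∀ m n → (m mod N) * (n mod N) ≡ (m ℕ.* n) mod N
  mod-homo-* m n = mod-cong (trans
    (cong₂ (λ x y → (x ℕ.* y) % N) (toℕ-mod m) (toℕ-mod n))
    (sym (%-distribˡ-* m n N)))

  -- A view of residues as classes of naturals: matching on it turns a law of ℤ/N, via `mod-homo-+`
  -- and `mod-homo-*`, into the same law of ℕ under `_mod N`.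
  data Residue : ℤ/ N → Set where
    residue : ∀ n → Residue (n mod N)

  toResidue : ∀ a → Residue a
  toResidue a = subst Residue (mod-toℕ a) (residue (toℕ a))

  +-interchange : ∀ (a b c d : ℤ/ N) → (a + b) + (c + d) ≡ (a + c) + (b + d)
  +-interchange a b c d with toResidue a | toResidue b | toResidue c | toResidue d
  ... | residue x | residue y | residue z | residue w
    rewrite mod-homo-+ x y | mod-homo-+ z w | mod-homo-+ x z | mod-homo-+ y w
          | mod-homo-+ (x ℕ.+ y) (z ℕ.+ w) | mod-homo-+ (x ℕ.+ z) (y ℕ.+ w)
    = cong (_mod N) (lemma x y z w)
    where
    lemma : ∀ x y z w → (x ℕ.+ y) ℕ.+ (z ℕ.+ w) ≡ (x ℕ.+ z) ℕ.+ (y ℕ.+ w)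
    lemma = solve-∀

  +-comm : ∀ (a b : ℤ/ N) → a + b ≡ b + a
  +-comm a b = cong (_mod N) (ℕₚ.+-comm (toℕ a) (toℕ b))

  +-identityʳ : ∀ (a : ℤ/ N) → a + 0# ≡ a
  +-identityʳ a with toResidue a
  ... | residue x = trans (mod-homo-+ x 0) (cong (_mod N) (ℕₚ.+-identityʳ x))

  *-zeroˡ : ∀ (a : ℤ/ N) → 0# * a ≡ 0#
  *-zeroˡ a with toResidue a
  ... | residue x = mod-homo-* 0 x

  *-zeroʳ : ∀ (a : ℤ/ N) → a * 0# ≡ 0#
  *-zeroʳ a with toResidue a
  ... | residue x = trans (mod-homo-* x 0) (cong (_mod N) (ℕₚ.*-zeroʳ x))

  *-identityʳ : ∀ (a : ℤ/ N) → a * (1 mod N) ≡ a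
  *-identityʳ a with toResidue a
  ... | residue x = trans (mod-homo-* x 1) (cong (_mod N) (ℕₚ.*-identityʳ x))

  *-assoc : ∀ (a b c : ℤ/ N) → (a * b) * c ≡ a * (b * c)
  *-assoc a b c with toResidue a | toResidue b | toResidue c
  ... | residue x | residue y | residue z
    rewrite mod-homo-* x y | mod-homo-* y z | mod-homo-* (x ℕ.* y) z | mod-homo-* x (y ℕ.* z)
    = cong (_mod N) (ℕₚ.*-assoc x y z)

  *-distribʳ-+ : ∀ (c a b : ℤ/ N) → (a + b) * c ≡ a * c + b * c
  *-distribʳ-+ c a b with toResidue a | toResidue b | toResidue c
  ... | residue x | residue y | residue z
    rewrite mod-homo-+ x y | mod-homo-* (x ℕ.+ y) z | mod-homo-* x z | mod-homo-* y z
          | mod-homo-+ (x ℕ.* z) (y ℕ.* z)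
    = cong (_mod N) (ℕₚ.*-distribʳ-+ z x y)

  *-distribˡ-+ : ∀ (c a b : ℤ/ N) → c * (a + b) ≡ c * a + c * b
  *-distribˡ-+ c a b with toResidue a | toResidue b | toResidue c
  ... | residue x | residue y | residue z
    rewrite mod-homo-+ x y | mod-homo-* z (x ℕ.+ y) | mod-homo-* z x | mod-homo-* z y
          | mod-homo-+ (z ℕ.* x) (z ℕ.* y)
    = cong (_mod N) (ℕₚ.*-distribˡ-+ z x y)

  -- `pred N` serves as -1, which keeps negation and Bézout coefficients inside ℕ.
  m+[pred-N]*m≡m*N : ∀ m → m ℕ.+ pred N ℕ.* m ≡ m ℕ.* N
  m+[pred-N]*m≡m*N m = trans (cong (ℕ._* m) (ℕₚ.suc-pred N)) (ℕₚ.*-comm N m)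

  infix 8 -_

  -_ : ℤ/ N → ℤ/ N
  - a = (pred N ℕ.* toℕ a) mod N

  +-inverseʳ-assoc : ∀ (a b : ℤ/ N) → (a + b) + - b ≡ a
  +-inverseʳ-assoc a b = begin
    (a + b) + - b                                      ≡⟨ mod-homo-+ (toℕ a ℕ.+ toℕ b) (pred N ℕ.* toℕ b) ⟩
    (toℕ a ℕ.+ toℕ b ℕ.+ pred N ℕ.* toℕ b) mod N       ≡⟨ cong (_mod N) (ℕₚ.+-assoc (toℕ a) (toℕ b) _) ⟩
    (toℕ a ℕ.+ (toℕ b ℕ.+ pred N ℕ.* toℕ b)) mod N     ≡⟨ cong (λ x → (toℕ a ℕ.+ x) mod N) (m+[pred-N]*m≡m*N (toℕ b)) ⟩
    (toℕ a ℕ.+ toℕ b ℕ.* N) mod N                      ≡⟨ mod-+-multiple (toℕ a) (toℕ b) ⟩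
    toℕ a mod N                                        ≡⟨ mod-toℕ a ⟩
    a                                                  ∎
    where open ≡-Reasoning

  +-inverseˡ-assoc : ∀ (a b : ℤ/ N) → (a + - b) + b ≡ a
  +-inverseˡ-assoc a b = begin
    -- Padding `b` with `0#` lets the interchange law swap it with `- b`.
    (a + - b) + b          ≡⟨ cong (a + - b +_) (+-identityʳ b) ⟨
    (a + - b) + (b + 0#)   ≡⟨ +-interchange a (- b) b 0# ⟩
    (a + b) + (- b + 0#)   ≡⟨ cong (a + b +_) (+-identityʳ (- b)) ⟩
    (a + b) + - b          ≡⟨ +-inverseʳ-assoc a b ⟩
    a                      ∎
    where open ≡-Reasoning

  -- Coordinates of words as linear forms, and Bézout coefficients

  dot : ∀ {m} → Vec (ℤ/ N) m → Vec (ℤ/ N) m → ℤ/ N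
  dot []      []      = 0#
  dot (x ∷ a) (y ∷ c) = x * y + dot a c

  dot-homo-+ : ∀ {m} (a b c : Vec (ℤ/ N) m) → dot (a +ᵛ b) c ≡ dot a c + dot b c
  dot-homo-+ []      []      []      = sym (+-identityʳ 0#)
  dot-homo-+ (x ∷ a) (y ∷ b) (z ∷ c) = trans
    (cong₂ _+_ (*-distribʳ-+ z x y) (dot-homo-+ a b c))
    (+-interchange (x * z) (y * z) (dot a c) (dot b c))

  dot-homo-* : ∀ {m} t (b c : Vec (ℤ/ N) m) → dot (t *ᵛ b) c ≡ t * dot b c
  dot-homo-* t []      []      = sym (*-zeroʳ t)
  dot-homo-* t (x ∷ b) (y ∷ c) = trans
    (cong₂ _+_ (*-assoc t x y) (dot-homo-* t b c))
    (sym (*-distribˡ-+ t (x * y) (dot b c)))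

  dot-zeroˡ : ∀ {m} (c : Vec (ℤ/ N) m) → dot 0ᵛ c ≡ 0#
  dot-zeroˡ []      = refl
  dot-zeroˡ (x ∷ c) = trans (cong₂ _+_ (*-zeroˡ x) (dot-zeroˡ c)) (+-identityʳ 0#)

  -- Makes each coordinate of a word a linear form in the coefficients, so that zeros can be counted
  -- one column at a time.
  lookup-linearCombination : ∀ {m n} (a : Vec (ℤ/ N) m) (g : Matrix N m n) i →
    lookup (linearCombination a g) i ≡ dot a (column g i)
  lookup-linearCombination []      []        i = lookup-replicate i 0#
  lookup-linearCombination (x ∷ a) (row ∷ g) i = trans
    (lookup-zipWith _+_ i (x *ᵛ row) (linearCombination a g))
    (cong₂ _+_ (lookup-map i (x *_) row) (lookup-linearCombination a g i))

  -- Over ℕ, Bézout's identity has one coefficient on the wrong side of the equation; modulo `N` it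
  -- moves across when multiplied by `pred N`.
  bézout : ∀ x G → ∃[ u ] ∃[ v ] (u ℕ.* x ℕ.+ v ℕ.* G) mod N ≡ gcd x G mod N
  bézout x G with Bézout.identity (gcd-GCD x G)
  ... | Bézout.+- u v eq = u , pred N ℕ.* v , (begin
    (u ℕ.* x ℕ.+ pred N ℕ.* v ℕ.* G) mod N                   ≡⟨ cong (λ y → (y ℕ.+ pred N ℕ.* v ℕ.* G) mod N) eq ⟨
    (gcd x G ℕ.+ v ℕ.* G ℕ.+ pred N ℕ.* v ℕ.* G) mod N       ≡⟨ cong (_mod N) (lemma (gcd x G) v G (pred N)) ⟩
    (gcd x G ℕ.+ (v ℕ.* G ℕ.+ pred N ℕ.* (v ℕ.* G))) mod N   ≡⟨ cong (λ y → (gcd x G ℕ.+ y) mod N) (m+[pred-N]*m≡m*N (v ℕ.* G)) ⟩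
    (gcd x G ℕ.+ v ℕ.* G ℕ.* N) mod N                        ≡⟨ mod-+-multiple (gcd x G) (v ℕ.* G) ⟩
    gcd x G mod N                                            ∎)
    where
    open ≡-Reasoning
    lemma : ∀ d v G k → d ℕ.+ v ℕ.* G ℕ.+ k ℕ.* v ℕ.* G ≡ d ℕ.+ (v ℕ.* G ℕ.+ k ℕ.* (v ℕ.* G))
    lemma = solve-∀
  ... | Bézout.-+ u v eq = pred N ℕ.* u , v , (begin
    (pred N ℕ.* u ℕ.* x ℕ.+ v ℕ.* G) mod N                   ≡⟨ cong (λ y → (pred N ℕ.* u ℕ.* x ℕ.+ y) mod N) eq ⟨
    (pred N ℕ.* u ℕ.* x ℕ.+ (gcd x G ℕ.+ u ℕ.* x)) mod N     ≡⟨ cong (_mod N) (lemma (gcd x G) u x (pred N)) ⟩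
    (gcd x G ℕ.+ (u ℕ.* x ℕ.+ pred N ℕ.* (u ℕ.* x))) mod N   ≡⟨ cong (λ y → (gcd x G ℕ.+ y) mod N) (m+[pred-N]*m≡m*N (u ℕ.* x)) ⟩
    (gcd x G ℕ.+ u ℕ.* x ℕ.* N) mod N                        ≡⟨ mod-+-multiple (gcd x G) (u ℕ.* x) ⟩
    gcd x G mod N                                            ∎)
    where
    open ≡-Reasoning
    lemma : ∀ d u x k → k ℕ.* u ℕ.* x ℕ.+ (d ℕ.+ u ℕ.* x) ≡ d ℕ.+ (u ℕ.* x ℕ.+ k ℕ.* (u ℕ.* x))
    lemma = solve-∀

  dot-attains-gcd : ∀ {m} (c : Vec (ℤ/ N) m) → ∃[ b ] dot b c ≡ foldr′ gcd N (map toℕ c) mod N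
  -- The gcd of the empty column is the initial value `N`, which is 0 modulo `N`.
  dot-attains-gcd []      = [] , sym (trans (cong (_mod N) (sym (ℕₚ.+-identityʳ N))) (mod-+-multiple 0 1))
  dot-attains-gcd (x ∷ c) with dot-attains-gcd c | bézout (toℕ x) (foldr′ gcd N (map toℕ c))
  -- The tail vector `b` attains the gcd `G` of the tail; scaling it by `v` and putting `u` in front
  -- realises the Bézout combination of the head and `G`.
  ... | b , eq | u , v , uv = (u mod N) ∷ ((v mod N) *ᵛ b) , (begin
    (u mod N) * x + dot ((v mod N) *ᵛ b) c                 ≡⟨ cong₂ _+_ (cong ((u mod N) *_) (sym (mod-toℕ x))) (dot-homo-* (v mod N) b c) ⟩
    (u mod N) * (toℕ x mod N) + (v mod N) * dot b c        ≡⟨ cong (λ y → (u mod N) * (toℕ x mod N) + (v mod N) * y) eq ⟩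
    (u mod N) * (toℕ x mod N) + (v mod N) * (G mod N)      ≡⟨ cong₂ _+_ (mod-homo-* u (toℕ x)) (mod-homo-* v G) ⟩
    ((u ℕ.* toℕ x) mod N) + ((v ℕ.* G) mod N)              ≡⟨ mod-homo-+ (u ℕ.* toℕ x) (v ℕ.* G) ⟩
    (u ℕ.* toℕ x ℕ.+ v ℕ.* G) mod N                        ≡⟨ uv ⟩
    gcd (toℕ x) G mod N                                    ∎)
    where
    open ≡-Reasoning
    G = foldr′ gcd N (map toℕ c)

-- Finite sums

∑-const : ∀ n x → ∑[ i < n ] x ≡ n ℕ.* x
∑-const zero    x = refl
∑-const (suc n) x = cong (x ℕ.+_) (∑-const n x)

∑-mono-≤ : ∀ {n} (f g : Fin n → ℕ) → (∀ i → f i ≤ g i) → Σ f ≤ Σ g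
∑-mono-≤ {zero}  f g f≤g = z≤n
∑-mono-≤ {suc n} f g f≤g = ℕₚ.+-mono-≤ (f≤g zero) (∑-mono-≤ (f ∘ suc) (g ∘ suc) (f≤g ∘ suc))

∑-mono-< : ∀ {n} (f g : Fin n → ℕ) → (∀ i → f i ≤ g i) → ∀ j → f j < g j → Σ f < Σ g
∑-mono-< f g f≤g zero    fj<gj = ℕₚ.+-mono-<-≤ fj<gj (∑-mono-≤ (f ∘ suc) (g ∘ suc) (f≤g ∘ suc))
∑-mono-< f g f≤g (suc j) fj<gj = ℕₚ.+-mono-≤-< (f≤g zero) (∑-mono-< (f ∘ suc) (g ∘ suc) (f≤g ∘ suc) j fj<gj)

term≤∑ : ∀ {n} (f : Fin n → ℕ) j → f j ≤ Σ f
term≤∑ f zero    = ℕₚ.m≤m+n (f zero) _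
term≤∑ f (suc j) = ℕₚ.≤-trans (term≤∑ (f ∘ suc) j) (ℕₚ.m≤n+m _ (f zero))

module _ {N : ℕ} where

  -- Iterating over coordinates reduces each property to one of single sums by induction on the
  -- length. The sum of the constant 1 is the number N^m of vectors.
  ∑ᵛ : ∀ {m} → (Vec (ℤ/ N) m → ℕ) → ℕ
  ∑ᵛ {zero}  f = f []
  ∑ᵛ {suc m} f = ∑[ x < N ] ∑ᵛ (λ a → f (x ∷ a))

  ∑ᵛ-cong : ∀ {m} {f g : Vec (ℤ/ N) m → ℕ} → (∀ a → f a ≡ g a) → ∑ᵛ f ≡ ∑ᵛ g
  ∑ᵛ-cong {zero}  f≗g = f≗g []
  ∑ᵛ-cong {suc m} f≗g = sum-cong-≗ (λ x → ∑ᵛ-cong (λ a → f≗g (x ∷ a)))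

  ∑ᵛ-mono-≤ : ∀ {m} {f g : Vec (ℤ/ N) m → ℕ} → (∀ a → f a ≤ g a) → ∑ᵛ f ≤ ∑ᵛ g
  ∑ᵛ-mono-≤ {zero}  f≤g = f≤g []
  ∑ᵛ-mono-≤ {suc m} f≤g = ∑-mono-≤ _ _ (λ x → ∑ᵛ-mono-≤ (λ a → f≤g (x ∷ a)))

  ∑ᵛ-mono-< : ∀ {m} {f g : Vec (ℤ/ N) m → ℕ} → (∀ a → f a ≤ g a) →
    ∀ b → f b < g b → ∑ᵛ f < ∑ᵛ g
  ∑ᵛ-mono-< f≤g []      fb<gb = fb<gb
  ∑ᵛ-mono-< f≤g (y ∷ b) fb<gb = ∑-mono-< _ _
    (λ x → ∑ᵛ-mono-≤ (λ a → f≤g (x ∷ a))) y (∑ᵛ-mono-< (λ a → f≤g (y ∷ a)) b fb<gb)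

  ∑ᵛ-∑-comm : ∀ {m n} (f : Vec (ℤ/ N) m → Fin n → ℕ) →
    ∑ᵛ (λ a → ∑[ i < n ] f a i) ≡ ∑[ i < n ] ∑ᵛ (λ a → f a i)
  ∑ᵛ-∑-comm {zero}      f = refl
  ∑ᵛ-∑-comm {suc m} {n} f = trans
    (sum-cong-≗ (λ x → ∑ᵛ-∑-comm (λ a → f (x ∷ a))))
    (∑-comm (λ x i → ∑ᵛ (λ a → f (x ∷ a) i)))

module _ {N : ℕ} .{{_ : NonZero N}} where

  -- Adding `c` permutes the residues, with adding `- c` as its inverse.
  ∑-translate : ∀ (f : ℤ/ N → ℕ) c → ∑[ x < N ] f (x + c) ≡ ∑[ x < N ] f x
  ∑-translate f c = sym (∑-permute f
    (permutation (_+ c) (_+ - c) (λ x → +-inverseˡ-assoc x c) (λ x → +-inverseʳ-assoc x c)))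

  ∑ᵛ-translate : ∀ {m} (f : Vec (ℤ/ N) m → ℕ) b → ∑ᵛ (λ a → f (a +ᵛ b)) ≡ ∑ᵛ f
  ∑ᵛ-translate f []      = refl
  ∑ᵛ-translate f (y ∷ b) = trans
    (sum-cong-≗ (λ x → ∑ᵛ-translate (λ a → f ((x + y) ∷ a)) b))
    (∑-translate (λ x → ∑ᵛ (λ a → f (x ∷ a))) y)

-- Counting zeros

-- An indicator with values in ℕ, so that counts are sums. It matches on constructors; for variable
-- `N` the term `0#` does not reduce to `zero`, and `[0#≡0]≡1` bridges the gap.
[_≡0] : ∀ {n} → Fin n → ℕ
[ zero  ≡0] = 1
[ suc _ ≡0] = 0

toℕ≡0⇒[≡0]≡1 : ∀ {n} (x : Fin n) → toℕ x ≡ 0 → [ x ≡0] ≡ 1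
toℕ≡0⇒[≡0]≡1 zero _ = refl

module _ {N : ℕ} .{{_ : NonZero N}} where

  toℕ-0# : toℕ (0# {N}) ≡ 0
  toℕ-0# = trans (toℕ-mod 0) (m<n⇒m%n≡m (ℕ.>-nonZero⁻¹ N))

  [0#≡0]≡1 : [ 0# {N} ≡0] ≡ 1
  [0#≡0]≡1 = toℕ≡0⇒[≡0]≡1 0# toℕ-0#

∑-[≡0] : ∀ N .{{_ : NonZero N}} → ∑[ x < N ] [ x ≡0] ≡ 1
∑-[≡0] (suc n) = cong suc (trans (∑-const n 0) (ℕₚ.*-zeroʳ n))

module _ {N : ℕ} .{{_ : NonZero N}} where

  -- The double count of the pairs (a , t) with dot (a + t b) c ≡ 0, where dot b c ≡ 1.
  count-zeros : ∀ {m} (c : Vec (ℤ/ N) m) → foldr′ gcd N (map toℕ c) ≡ 1 →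
    N ℕ.* ∑ᵛ (λ a → [ dot a c ≡0]) ≡ ∑ᵛ {N} {m} (λ _ → 1)
  count-zeros {m} c gcd≡1 with dot-attains-gcd c
  ... | b , eq = begin
    N ℕ.* ∑ᵛ (λ a → [ dot a c ≡0])                            ≡⟨ ∑-const N _ ⟨
    ∑[ t < N ] ∑ᵛ (λ a → [ dot a c ≡0])                       ≡⟨ sum-cong-≗ (λ t → sym (∑ᵛ-translate (λ a → [ dot a c ≡0]) (t *ᵛ b))) ⟩
    ∑[ t < N ] ∑ᵛ (λ a → [ dot (a +ᵛ t *ᵛ b) c ≡0])           ≡⟨ sum-cong-≗ (λ t → ∑ᵛ-cong (λ a → cong [_≡0] (dot-step a t))) ⟩
    ∑[ t < N ] ∑ᵛ (λ a → [ t + dot a c ≡0])                   ≡⟨ ∑ᵛ-∑-comm (λ a t → [ t + dot a c ≡0]) ⟨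
    -- For fixed `a`, the value `t + dot a c` meets every residue once as `t` varies, so exactly one
    -- `t` contributes.
    ∑ᵛ (λ a → ∑[ t < N ] [ t + dot a c ≡0])                   ≡⟨ ∑ᵛ-cong (λ a → ∑-translate [_≡0] (dot a c)) ⟩
    ∑ᵛ {N} {m} (λ _ → ∑[ t < N ] [ t ≡0])                     ≡⟨ ∑ᵛ-cong {N} {m} (λ _ → ∑-[≡0] N) ⟩
    ∑ᵛ {N} {m} (λ _ → 1)                                      ∎
    where
    open ≡-Reasoning
    dot-step : ∀ a t → dot (a +ᵛ t *ᵛ b) c ≡ t + dot a c
    dot-step a t = begin
      dot (a +ᵛ t *ᵛ b) c          ≡⟨ dot-homo-+ a (t *ᵛ b) c ⟩
      dot a c + dot (t *ᵛ b) c     ≡⟨ cong (dot a c +_) (dot-homo-* t b c) ⟩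
      dot a c + t * dot b c        ≡⟨ cong (λ x → dot a c + t * x) (trans eq (cong (_mod N) gcd≡1)) ⟩
      dot a c + t * (1 mod N)      ≡⟨ cong (dot a c +_) (*-identityʳ t) ⟩
      dot a c + t                  ≡⟨ +-comm (dot a c) t ⟩
      t + dot a c                  ∎

  zeros : ∀ {m n} → Matrix N m n → Vec (ℤ/ N) m → ℕ
  zeros {n = n} g a = ∑[ i < n ] [ dot a (column g i) ≡0]

  zeros-0ᵛ : ∀ {m n} (g : Matrix N m n) → zeros g 0ᵛ ≡ n
  zeros-0ᵛ {n = n} g = trans
    (sum-cong-≗ (λ i → trans (cong [_≡0] (dot-zeroˡ (column g i))) [0#≡0]≡1))
    (trans (∑-const n 1) (ℕₚ.*-identityʳ n))

  -- Exchanging the sums counts zeros by columns, each of which vanishes at one N-th of the vectors.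
  -- The factor `N` on the left avoids division.
  total-zeros : ∀ {m n} (g : Matrix N m n) → (∀ i → columnGcd g i ≡ 1) →
    N ℕ.* ∑ᵛ (zeros g) ≡ n ℕ.* ∑ᵛ {N} {m} (λ _ → 1)
  total-zeros {m} {n} g gcd≡1 = begin
    N ℕ.* ∑ᵛ (zeros g)                                            ≡⟨ cong (N ℕ.*_) (∑ᵛ-∑-comm (λ a i → [ dot a (column g i) ≡0])) ⟩
    N ℕ.* (∑[ i < n ] ∑ᵛ (λ a → [ dot a (column g i) ≡0]))        ≡⟨ *-distribˡ-sum N (λ i → ∑ᵛ (λ a → [ dot a (column g i) ≡0])) ⟩
    ∑[ i < n ] (N ℕ.* ∑ᵛ (λ a → [ dot a (column g i) ≡0]))        ≡⟨ sum-cong-≗ {n} (λ i → count-zeros (column g i) (gcd≡1 i)) ⟩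
    ∑[ i < n ] ∑ᵛ {N} {m} (λ _ → 1)                               ≡⟨ ∑-const n _ ⟩
    n ℕ.* ∑ᵛ {N} {m} (λ _ → 1)                                    ∎
    where open ≡-Reasoning

  -- The bound for thin codes

  thin⇒1≤zeros : ∀ {m n ℓ} (C : LinearCode N n ℓ) (g : Matrix N m n) →
    IsGeneratingMatrix g C → Thin C → ∀ a → 1 ≤ zeros g a
  thin⇒1≤zeros C g gen thin a with zeros g a in eq
  ... | suc _ = s≤s z≤n
  -- A zero entry would add 1 to a count that is 0, so this word has only nonzero entries, against
  -- thinness.
  ... | zero  = contradiction
    (linearCombination a g , Equivalence.from (gen _) (a , refl) , lookup⁻ nonzero)
    thin
    where
    open ≤-Reasoning
    nonzero : ∀ i → lookup (linearCombination a g) i ≢ 0#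
    nonzero i wᵢ≡0 = ℕₚ.<-irrefl refl (begin-strict
      0                             <⟨ s≤s z≤n ⟩
      1                             ≡⟨ [0#≡0]≡1 ⟨
      [ 0# {N} ≡0]                  ≡⟨ cong [_≡0] (trans (sym wᵢ≡0) (lookup-linearCombination a g i)) ⟩
      [ dot a (column g i) ≡0]      ≤⟨ term≤∑ (λ i → [ dot a (column g i) ≡0]) i ⟩
      zeros g a                     ≡⟨ eq ⟩
      0                             ∎)

  thin⇒N≤d : ∀ {d m ℓ} → 2 ≤ N → (C : LinearCode N (suc d) ℓ) (g : Matrix N m (suc d)) →
    IsGeneratingMatrix g C → Thin C → (∀ i → columnGcd g i ≡ 1) → N ≤ d
  -- In length 1 the zero word has just one zero, so the count is not strict and yields only
  -- `N ≤ 1`, which `2≤N` refutes.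
  thin⇒N≤d {zero} {m} 2≤N C g gen thin gcd≡1 = contradiction 2≤N (ℕₚ.<⇒≱ (s≤s N≤1))
    where
    open ≤-Reasoning
    T = ∑ᵛ {N} {m} (λ _ → 1)
    instance
      T-nonZero : NonZero T
      -- Cancelling `T` from a weak inequality needs `T` positive: the constants 0 and 1 differ at
      -- the vector `0ᵛ`, so their sums differ strictly.
      T-nonZero = ℕ.>-nonZero (ℕₚ.≤-<-trans z≤n (∑ᵛ-mono-< {N} {m} {f = λ _ → 0} {g = λ _ → 1} (λ _ → z≤n) 0ᵛ ℕₚ.≤-refl))
    N≤1 : N ≤ 1
    N≤1 = ℕₚ.*-cancelʳ-≤ N 1 T (begin
      N ℕ.* T              ≤⟨ ℕₚ.*-monoʳ-≤ N (∑ᵛ-mono-≤ (thin⇒1≤zeros C g gen thin)) ⟩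
      N ℕ.* ∑ᵛ (zeros g)   ≡⟨ total-zeros g gcd≡1 ⟩
      1 ℕ.* T              ∎)
  -- The length is now at least 2, so the vector `0ᵛ` gives at least two zeros and makes the
  -- comparison strict; cancelling `T` leaves `N` below the length.
  thin⇒N≤d {suc d} {m} 2≤N C g gen thin gcd≡1 = ℕ.s≤s⁻¹ (ℕₚ.*-cancelʳ-< T N (suc (suc d)) (begin-strict
      N ℕ.* T              <⟨ ℕₚ.*-monoʳ-< N (∑ᵛ-mono-< (thin⇒1≤zeros C g gen thin) 0ᵛ 1<zeros) ⟩
      N ℕ.* ∑ᵛ (zeros g)   ≡⟨ total-zeros g gcd≡1 ⟩
      suc (suc d) ℕ.* T    ∎))
    where
    open ≤-Reasoning
    T = ∑ᵛ {N} {m} (λ _ → 1)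
    1<zeros : 1 < zeros g 0ᵛ
    1<zeros = subst (1 <_) (sym (zeros-0ᵛ g)) (s≤s (s≤s z≤n))

-- Prime modulus

foldr-gcd∣init : ∀ {N m n} (c : Vec (Fin n) m) → foldr′ gcd N (map toℕ c) ∣ N
foldr-gcd∣init         []      = ∣-refl
foldr-gcd∣init {N = N} (x ∷ c) = ∣-trans (gcd[m,n]∣n (toℕ x) _) (foldr-gcd∣init {N} c)

foldr-gcd∣lookup : ∀ {N m n} (c : Vec (Fin n) m) j → foldr′ gcd N (map toℕ c) ∣ toℕ (lookup c j)
foldr-gcd∣lookup         (x ∷ c) zero    = gcd[m,n]∣m (toℕ x) _
foldr-gcd∣lookup {N = N} (x ∷ c) (suc j) = ∣-trans (gcd[m,n]∣n (toℕ x) _) (foldr-gcd∣lookup {N} c j)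

-- The gcd divides the prime `N`, so it is 1 or `N`; in the second case `N` would divide a nonzero
-- entry smaller than itself.
prime⇒columnGcd≡1 : ∀ {N m n} .{{_ : NonZero N}} → Prime N → (g : Matrix N m n) →
  ∀ i → ∃[ j ] lookup (column g i) j ≢ 0# → columnGcd g i ≡ 1
prime⇒columnGcd≡1 {N} p g i (j , x≢0) with prime⇒irreducible p (foldr-gcd∣init {N} (column g i))
... | inj₁ gcd≡1 = gcd≡1
... | inj₂ gcd≡N = contradiction (∣⇒≤ N∣x) (ℕₚ.<⇒≱ (toℕ<n x))
  where
  x = lookup (column g i) j
  N∣x : N ∣ toℕ x
  N∣x = subst (_∣ toℕ x) gcd≡N (foldr-gcd∣lookup {N} (column g i) j)
  instance
    x-nonZero : NonZero (toℕ x)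
    x-nonZero = ℕ.≢-nonZero (λ eq → x≢0 (toℕ-injective (trans eq (sym toℕ-0#))))

-- For `N` = 1 and `d` = 0 the zero code is thin with column gcd 1 and violates the bound, hence
-- `2 ≤ N`. For prime `N` a zero column has gcd `N`, hence the condition that every column has a
-- nonzero entry.
corollary2p13 : ∀ {ℓ} (N d m : ℕ) .{{_ : NonZero N}} → 2 ≤ N →
    (C : LinearCode N (suc d) ℓ) (g : Matrix N m (suc d)) →
    Extended C → IsGeneratingMatrix g C → Thin C →
    ((∀ i → columnGcd g i ≡ 1) → d ≥ N) ×
    (Prime N → (∀ i → ∃[ j ] lookup (column g i) j ≢ 0#) → d ≥ N)
corollary2p13 N d m 2≤N C g _ gen thin =
  thin⇒N≤d 2≤N C g gen thin ,
  λ p nonzero → thin⇒N≤d 2≤N C g gen thin (λ i → prime⇒columnGcd≡1 p g i (nonzero i))
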